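{- Let $\delta>0$ be a constant. There does not exist a generalized locally optimal algorithm for weighted token swapping on general graphs which, on every instance, outputs a valid solution of cost at most $\left(2+\frac{2W}{w}-\delta\right)\cdot\mathrm{OPT}$, where $w$ and $W$ are the minimum and maximum token weights of the instance.
   Context: An instance of weighted token swapping consists of a connected simple undirected graph $G=(V,E)$ with $n=|V|$ vertices, a set $T$ of $n$ tokens, a weight function $\omega:T\to\mathbb{R}_{>0}$, and two bijections $v_0,v_f:T\to V$ (starting and destination vertices). At all times each vertex holds exactly one token; initially token $t$ is on $v_0(t)$. A swap along an edge $(u,u')\in E$ exchanges the tokens on $u$ and $u'$ and costs the sum of the weights of the two swapped tokens. A valid solution is a sequence of swaps after which every token $t$ is on $v_f(t)$; its cost is the sum of the costs of its swaps, and $\mathrm{OPT}$ is the minimum cost of a valid solution. An algorithm is generalized locally optimal if every swap it performs strictly decreases, for at least one of the two participating tokens $t$, the graph distance from the current vertex of $t$ to $v_f(t)$ or the graph distance from the current vertex of $t$ to $v_0(t)$. -}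

module Defs where

open import Data.Nat as ℕ using (ℕ; zero; suc)
open import Data.Fin using (Fin; _≟_)
open import Data.Fin.Permutation using (Permutation′; _⟨$⟩ˡ_)
open import Data.Bool using (Bool; T)
open import Data.List using (List; []; _∷_)
open import Data.List.Relation.Unary.All using (All)
open import Data.Product using (Σ; ∃; _×_; _,_)
open import Data.Sum using (_⊎_)
open import Data.Integer using (+_)
open import Data.Rational using (ℚ; 0ℚ; _+_; _*_; _-_; _÷_; _≤_; _<_; _/_)
import Data.Rational.Base as ℚB
open import Relation.Binary.PropositionalEquality using (_≡_; subst)
open import Relation.Nullary using (¬_; yes; no)

data Walk {n : ℕ} (adj : Fin n → Fin n → Bool) : Fin n → Fin n → ℕ → Set where
  here : ∀ {u} → Walk adj u u zero
  step : ∀ {u v x k} → T (adj u v) → Walk adj v x k → Walk adj u x (suc k)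

Dist : ∀ {n} → (Fin n → Fin n → Bool) → Fin n → Fin n → ℕ → Set
Dist adj u v d = Walk adj u v d × (∀ k → Walk adj u v k → d ℕ.≤ k)

-- An instance of weighted token swapping.  Vertices and tokens are both Fin n.
record Instance : Set where
  field
    n         : ℕ
    adj       : Fin n → Fin n → Bool
    symmetric : ∀ u v → adj u v ≡ adj v u
    loopless  : ∀ u → ¬ T (adj u u)
    connected : ∀ u v → ∃ λ k → Walk adj u v k
    weight    : Fin n → ℚ
    weightPos : ∀ t → 0ℚ < weight t
    v₀        : Permutation′ n   -- token ↦ starting vertex
    v-f       : Permutation′ n   -- token ↦ destination vertex

module _ (I : Instance) where
  open Instance I

  -- A configuration assigns to each vertex the token currently on it.
  Config : Set
  Config = Fin n → Fin n

  initial : Config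
  initial v = v₀ ⟨$⟩ˡ v

  swapAt : Fin n → Fin n → Config → Config
  swapAt u u' c v with v ≟ u
  ... | yes _ = c u'
  ... | no _ with v ≟ u'
  ...   | yes _ = c u
  ...   | no _ = c v

  Swap : Set
  Swap = Fin n × Fin n

  run : Config → List Swap → Config
  run c [] = c
  run c ((u , u') ∷ s) = run (swapAt u u' c) s

  costFrom : Config → List Swap → ℚ
  costFrom c [] = 0ℚ
  costFrom c ((u , u') ∷ s) = (weight (c u) + weight (c u')) + costFrom (swapAt u u' c) s

  cost : List Swap → ℚ
  cost s = costFrom initial s

  AllEdges : List Swap → Set
  AllEdges s = All (λ { (u , u') → T (adj u u') }) s

  Valid : List Swap → Set
  Valid s = AllEdges s × (∀ t → run initial s (v-f Data.Fin.Permutation.⟨$⟩ʳ t) ≡ t)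

  IsOPT : ℚ → Set
  IsOPT o = (Σ (List Swap) λ s → Valid s × cost s ≡ o) × (∀ s → Valid s → o ≤ cost s)

  Decreases : Fin n → Fin n → Fin n → Set
  Decreases a b x = ∃ λ da → ∃ λ db → Dist adj a x da × Dist adj b x db × db ℕ.< da

  GoodMove : Fin n → Fin n → Fin n → Set
  GoodMove t a b = Decreases a b (v-f Data.Fin.Permutation.⟨$⟩ʳ t)
                 ⊎ Decreases a b (v₀ Data.Fin.Permutation.⟨$⟩ʳ t)

  GLOSwap : Config → Fin n → Fin n → Set
  GLOSwap c u u' = GoodMove (c u) u u' ⊎ GoodMove (c u') u' u

  GLOFrom : Config → List Swap → Set
  GLOFrom c [] = Data.Unit.⊤ where import Data.Unit
  GLOFrom c ((u , u') ∷ s) = GLOSwap c u u' × GLOFrom (swapAt u u' c) s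

  GeneralizedLocallyOptimal : List Swap → Set
  GeneralizedLocallyOptimal s = GLOFrom initial s

  IsMinWeight : ℚ → Set
  IsMinWeight w = (∃ λ t → weight t ≡ w) × (∀ t → w ≤ weight t)

  IsMaxWeight : ℚ → Set
  IsMaxWeight W = (∃ λ t → weight t ≡ W) × (∀ t → weight t ≤ W)

  minWeight-pos : ∀ {w} → IsMinWeight w → 0ℚ < w
  minWeight-pos ((t , eq) , _) = subst (0ℚ <_) eq (weightPos t)

two : ℚ
two = + 2 / 1

factor : (δ w W : ℚ) → 0ℚ < w → ℚ
factor δ w W wpos = (two + _÷_ (two * W) w {{ℚB.>-nonZero wpos}}) - δ

GLOApproxAlgorithm : ℚ → ((I : Instance) → List (Swap I)) → Set
GLOApproxAlgorithm δ A =
  ∀ (I : Instance) →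
    Valid I (A I) × GeneralizedLocallyOptimal I (A I) ×
    (∀ w W o → (mw : IsMinWeight I w) → IsMaxWeight I W → IsOPT I o →
       cost I (A I) ≤ factor δ w W (minWeight-pos I mw) * o)

{-# OPTIONS --safe #-}

-- With unit weights the factor is 4 − δ.  Take the product of a complete graph
-- (the layers 0, …, k, layer 0 being the hub) with a cycle of length k².  In every
-- other layer k travelling tokens, at distance k from each other, have to move by k
-- (clockwise or counterclockwise, depending on the layer); all other tokens are at home.
-- A swap between two layers is never good while every token is in its own layer, so
-- a generalized locally optimal algorithm has to solve every layer on its cycle alone.
-- The displacements on a cycle sum to zero, so travelling k distances of k each
-- forces about as much movement backwards, and nearly every token at home is moved twice:
-- about 2k² swaps per layer.  In the hub, clockwise travellers can instead be exchanged
-- with counterclockwise ones, which solves all layers with about k³/2 swaps.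
module Submission where

open import Defs
open import Data.Bool using (Bool; T; if_then_else_)
open import Data.Empty using (⊥)
open import Data.Fin as Fin using (Fin; zero; suc; toℕ; combine; remQuot; _≟_)
open import Data.Fin.Permutation as Perm using (Permutation′; _⟨$⟩ʳ_; _⟨$⟩ˡ_; _∘ₚ_)
import Data.Fin.Permutation.Components as PC
import Data.Fin.Properties as Fin
open import Data.Integer as ℤ using (+_; -[1+_])
import Data.Integer.Properties as ℤ
import Data.Integer.Tactic.RingSolver as ℤ-Solver
open import Data.List using (List; []; _∷_; _++_; [_]; length; map; reverse; filter; allFin)
open import Data.List.Membership.Propositional using (_∈_)
open import Data.List.Membership.Propositional.Properties using (∈-allFin; ∈-filter⁺; ∈-filter⁻)
open import Data.List.Properties
  using (unfold-reverse; length-reverse; length-++; length-map; length-tabulate; reverse-map)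
open import Data.List.Relation.Unary.All as All using (All; []; _∷_)
import Data.List.Relation.Unary.All.Properties as All
open import Data.List.Relation.Unary.AllPairs using ([]; _∷_)
open import Data.List.Relation.Unary.Any using (here; there)
open import Data.List.Relation.Unary.Unique.Propositional using (Unique)
import Data.List.Relation.Unary.Unique.Propositional.Properties as Unique
open import Data.Nat as ℕ hiding (_≟_; _/_)
open import Data.Nat.DivMod
open import Data.Nat.Divisibility using (_∣_; divides; ∣-trans)
open import Data.Nat.Properties hiding (_≟_)
open import Data.Nat.Tactic.RingSolver using (solve-∀)
open import Data.Product using (∃; _×_; _,_; proj₁; proj₂)
open import Data.Rational as ℚ using (ℚ; 0ℚ; 1ℚ; mkℚ; toℚᵘ)
import Data.Rational.Properties as ℚ
open import Data.Rational.Unnormalised as ℚᵘ using (mkℚᵘ; *≡*; *≤*)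
import Data.Rational.Unnormalised.Properties as ℚᵘ
open import Data.Sum using (inj₁; inj₂)
open import Function using (_∘_; id)
open import Function.Bundles using (mk⇔)
open import Relation.Binary.Definitions using (tri<; tri≈; tri>)
open import Relation.Binary.PropositionalEquality hiding ([_])
open import Relation.Nullary
open import Relation.Nullary.Decidable using (does-⇔; dec-true; ¬?)
open import Algebra.Properties.CommutativeMonoid.Sum +-0-commutativeMonoid
  using (sum; sum-cong-≗; ∑-distrib-+; sum-permute)

private variable
  n : ℕ

-- Transpositions, swap sequences as permutations, and matchings.

transpose-fst : (u v : Fin n) → PC.transpose u v u ≡ v
transpose-fst u v with u Fin.≟ u
... | yes _ = refl
... | no u≢u = contradiction refl u≢u

transpose-snd : (u v : Fin n) → PC.transpose u v v ≡ u
transpose-snd u v with v Fin.≟ u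
... | yes v≡u = v≡u
... | no _ with v Fin.≟ v
...   | yes _ = refl
...   | no v≢v = contradiction refl v≢v

transpose-other : {u v x : Fin n} → x ≢ u → x ≢ v → PC.transpose u v x ≡ x
transpose-other {u = u} {v} {x} x≢u x≢v with x Fin.≟ u
... | yes x≡u = contradiction x≡u x≢u
... | no _ with x Fin.≟ v
...   | yes x≡v = contradiction x≡v x≢v
...   | no _ = refl

transpose-comm : (u v x : Fin n) → PC.transpose u v x ≡ PC.transpose v u x
transpose-comm u v x = by-cases (x Fin.≟ u) (x Fin.≟ v)
  where
  by-cases : Dec (x ≡ u) → Dec (x ≡ v) → PC.transpose u v x ≡ PC.transpose v u x
  by-cases (yes refl) _ = trans (transpose-fst x v) (sym (transpose-snd v x))
  by-cases (no _) (yes refl) = trans (transpose-snd u x) (sym (transpose-fst x u))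
  by-cases (no x≢u) (no x≢v) = trans (transpose-other x≢u x≢v) (sym (transpose-other x≢v x≢u))

swaps-perm : List (Fin n × Fin n) → Permutation′ n
swaps-perm [] = Perm.id
swaps-perm ((u , u') ∷ s) = Perm.transpose u u' ∘ₚ swaps-perm s

opaque
  -- The final position of the token that starts on v.
  track : List (Fin n × Fin n) → Fin n → Fin n
  track s v = swaps-perm s ⟨$⟩ʳ v

  track-≡ : (s : List (Fin n × Fin n)) (v : Fin n) → track s v ≡ swaps-perm s ⟨$⟩ʳ v
  track-≡ s v = refl

  track-[] : (v : Fin n) → track [] v ≡ v
  track-[] v = refl

  track-∷ : (u u' : Fin n) (s : List (Fin n × Fin n)) {v w : Fin n} →
    PC.transpose u u' v ≡ w → track ((u , u') ∷ s) v ≡ track s w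
  track-∷ u u' s refl = refl

  track-++ : (s s' : List (Fin n × Fin n)) (v : Fin n) → track (s ++ s') v ≡ track s' (track s v)
  track-++ [] s' v = refl
  track-++ ((u , u') ∷ s) s' v = track-++ s s' (PC.transpose u u' v)

-- Each transposition is its own inverse, so undoing the swaps from last to first returns every
-- token. This reduces layers whose tokens travel backwards to the case of tokens that travel
-- forwards.
track-reverse : (s : List (Fin n × Fin n)) (v : Fin n) → track (reverse s) (track s v) ≡ v
track-reverse [] v = trans (track-[] _) (track-[] v)
track-reverse ((u , u') ∷ s) v = begin
  track (reverse ((u , u') ∷ s)) (track ((u , u') ∷ s) v)
    ≡⟨ cong₂ track (unfold-reverse (u , u') s) (track-∷ u u' s refl) ⟩
  track (reverse s ++ [ (u , u') ]) (track s w)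
    ≡⟨ track-++ (reverse s) [ (u , u') ] (track s w) ⟩
  track [ (u , u') ] (track (reverse s) (track s w))
    ≡⟨ cong (track [ (u , u') ]) (track-reverse s w) ⟩
  track [ (u , u') ] w
    ≡⟨ track-∷ u u' [] (trans (cong (PC.transpose u u') (transpose-comm u u' v))
         (PC.transpose-inverse u u')) ⟩
  track [] v
    ≡⟨ track-[] v ⟩
  v ∎
  where
  open ≡-Reasoning
  w = PC.transpose u u' v

module Matching {A : Set} (a b : A → Fin n) where

  swaps : List A → List (Fin n × Fin n)
  swaps = map (λ x → a x , b x)

  Disjoint : A → A → Set
  Disjoint x y = (a x ≢ a y × a x ≢ b y) × (b x ≢ a y × b x ≢ b y)

  PairwiseDisjoint : List A → Set
  PairwiseDisjoint xs = ∀ {x y} → x ∈ xs → y ∈ xs → x ≢ y → Disjoint x y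

  track-unmatched : ∀ xs {v} → (∀ {x} → x ∈ xs → v ≢ a x × v ≢ b x) → track (swaps xs) v ≡ v
  track-unmatched [] v∉ = track-[] _
  track-unmatched (x ∷ xs) v∉ =
    trans (track-∷ (a x) (b x) (swaps xs)
            (transpose-other (proj₁ (v∉ (here refl))) (proj₂ (v∉ (here refl)))))
          (track-unmatched xs (v∉ ∘ there))

  -- Disjointness leaves a single swap of the list that touches `a x` or `b x`, so each of the two
  -- tokens moves exactly once and the order of the list is irrelevant.
  track-matched : ∀ xs → Unique xs → PairwiseDisjoint xs → ∀ {x} → x ∈ xs →
    track (swaps xs) (a x) ≡ b x × track (swaps xs) (b x) ≡ a x
  track-matched (x ∷ xs) (x≢ ∷ _) dis (here refl) =
      trans (track-∷ (a x) (b x) (swaps xs) (transpose-fst (a x) (b x)))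
            (track-unmatched xs (λ y∈ → proj₂ (dis (here refl) (there y∈) (All.lookup x≢ y∈))))
    , trans (track-∷ (a x) (b x) (swaps xs) (transpose-snd (a x) (b x)))
            (track-unmatched xs (λ y∈ → proj₁ (dis (here refl) (there y∈) (All.lookup x≢ y∈))))
  track-matched (x ∷ xs) (x≢ ∷ u) dis {y} (there y∈)
    with dis (there y∈) (here refl) (All.lookup x≢ y∈ ∘ sym)
       | track-matched xs u (λ p q → dis (there p) (there q)) y∈
  ... | (aa , ab) , (ba , bb) | iha , ihb =
      trans (track-∷ (a x) (b x) (swaps xs) (transpose-other aa ab)) iha
    , trans (track-∷ (a x) (b x) (swaps xs) (transpose-other ba bb)) ihb

-- Finite sums and remainders.

sum-mono : {f g : Fin n → ℕ} → (∀ i → f i ≤ g i) → sum f ≤ sum g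
sum-mono {zero} f≤g = z≤n
sum-mono {suc n} f≤g = +-mono-≤ (f≤g zero) (sum-mono (f≤g ∘ suc))

sum-const : ∀ n c → sum {n} (λ _ → c) ≡ n * c
sum-const zero c = refl
sum-const (suc n) c = cong (_+_ c) (sum-const n c)

sum-mono-strict : {f g : Fin n → ℕ} → (∀ i → f i ≤ g i) → ∀ i → f i < g i → sum f < sum g
sum-mono-strict f≤g zero f<g = +-mono-<-≤ f<g (sum-mono (f≤g ∘ suc))
sum-mono-strict f≤g (suc i) f<g = +-mono-≤-< (f≤g zero) (sum-mono-strict (f≤g ∘ suc) i f<g)

-- Otherwise `g` is at most `f` everywhere and smaller at `i`, so the sums would differ.
sum≡⇒∃< : {f g : Fin n → ℕ} → sum f ≡ sum g → ∀ i → f i ≢ g i → ∃ λ j → f j < g j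
sum≡⇒∃< {f = f} {g} eq i fi≢gi with Fin.any? (λ j → f j <? g j)
... | yes ∃j = ∃j
... | no ∄j = contradiction (sum-mono-strict g≤f i (≤∧≢⇒< (g≤f i) (fi≢gi ∘ sym))) (<-irrefl (sym eq))
  where
  g≤f : ∀ j → g j ≤ f j
  g≤f j = ≮⇒≥ (λ f<g → ∄j (j , f<g))

sum-≥-single : (f : Fin n → ℕ) (i : Fin n) → f i ≤ sum f
sum-≥-single f zero = m≤m+n (f zero) _
sum-≥-single f (suc i) = ≤-trans (sum-≥-single (f ∘ suc) i) (m≤n+m _ (f zero))

sum-≥-exceptional : (f : Fin (suc n) → ℕ) (B C : ℕ) → (∀ i → B ≤ f i) →
  ∀ i → C ≤ f i → C + n * B ≤ sum f
sum-≥-exceptional {n} f B C B≤ zero C≤ =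
  +-mono-≤ C≤ (≤-trans (≤-reflexive (sym (sum-const n B))) (sum-mono (B≤ ∘ suc)))
sum-≥-exceptional {suc n} f B C B≤ (suc i) C≤ = begin
  C + (B + n * B)       ≡⟨ solve-∀′ C B (n * B) ⟩
  B + (C + n * B)       ≤⟨ +-mono-≤ (B≤ zero) (sum-≥-exceptional (f ∘ suc) B C (B≤ ∘ suc) i C≤) ⟩
  sum f ∎
  where
  open ≤-Reasoning
  solve-∀′ : ∀ x y z → x + (y + z) ≡ y + (x + z)
  solve-∀′ = solve-∀

indicator : Fin n → Fin n → ℕ
indicator u v = if does (v Fin.≟ u) then 1 else 0

sum-zero : ∀ n → sum {n} (λ _ → 0) ≡ 0
sum-zero n = trans (sum-const n 0) (*-zeroʳ n)

indicator-yes : (u : Fin n) → indicator u u ≡ 1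
indicator-yes u with u Fin.≟ u
... | yes _ = refl
... | no u≢u = contradiction refl u≢u

indicator-no : {u v : Fin n} → v ≢ u → indicator u v ≡ 0
indicator-no {u = u} {v} v≢u with v Fin.≟ u
... | yes v≡u = contradiction v≡u v≢u
... | no _ = refl

sum-indicator : (u : Fin n) → sum (indicator u) ≡ 1
sum-indicator {suc n} zero = cong suc
  (trans (sum-cong-≗ {n} (λ i → indicator-no {u = zero} {suc i} λ ())) (sum-zero n))
sum-indicator {suc n} (suc u) = sum-indicator u

sum-toℕ-++ : ∀ m n (h : ℕ → ℕ) →
  sum {m + n} (h ∘ toℕ) ≡ sum {m} (h ∘ toℕ) + sum {n} (λ i → h (m + toℕ i))
sum-toℕ-++ zero n h = refl
sum-toℕ-++ (suc m) n h = trans (cong (_+_ (h 0)) (sum-toℕ-++ m n (h ∘ suc))) (sym (+-assoc (h 0) _ _))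

sum-toℕ-* : ∀ m k (h : ℕ → ℕ) →
  sum {m * k} (h ∘ toℕ) ≡ sum {m} (λ a → sum {k} (λ i → h (toℕ a * k + toℕ i)))
sum-toℕ-* zero k h = refl
sum-toℕ-* (suc m) k h = trans (sum-toℕ-++ k (m * k) h) (cong (_+_ (sum {k} (h ∘ toℕ)))
  (trans (sum-toℕ-* m k (h ∘ (_+_ k)))
    (sum-cong-≗ {m} (λ a → sum-cong-≗ {k} (λ i → cong h (sym (+-assoc k _ _)))))))

suc-% : ∀ m d .{{_ : NonZero d}} → suc (m % d) % d ≡ suc m % d
suc-% m d = sym (trans (cong (λ x → suc x % d) (m≡m%n+[m/n]*n m d))
  ([m+kn]%n≡m%n (suc (m % d)) (m / d) d))

-- Equal remainders and `a < b` force a larger quotient for `b`, hence a gap of at least one full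
-- period.
%-≡-< : ∀ {a b} d .{{_ : NonZero d}} → a % d ≡ b % d → a < b → a + d ≤ b
%-≡-< {a} {b} d eq a<b = begin
  a + d                             ≡⟨ cong (_+ d) (m≡m%n+[m/n]*n a d) ⟩
  a % d + (a / d) * d + d           ≡⟨ regroup (a % d) (a / d) d ⟩
  a % d + suc (a / d) * d           ≤⟨ +-mono-≤ (≤-reflexive eq) (*-monoˡ-≤ d quotient<) ⟩
  b % d + (b / d) * d               ≡⟨ m≡m%n+[m/n]*n b d ⟨
  b ∎
  where
  open ≤-Reasoning
  regroup : ∀ r q e → r + q * e + e ≡ r + suc q * e
  regroup = solve-∀
  quotient< : a / d < b / d
  quotient< = ≰⇒> λ b/d≤a/d → <-irrefl refl (<-≤-trans a<b (begin
    b                      ≡⟨ m≡m%n+[m/n]*n b d ⟩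
    b % d + (b / d) * d    ≤⟨ +-mono-≤ (≤-reflexive (sym eq)) (*-monoˡ-≤ d b/d≤a/d) ⟩
    a % d + (a / d) * d    ≡⟨ m≡m%n+[m/n]*n a d ⟨
    a ∎))

-- Swap sequences on a cycle.

module Cycle (l : ℕ) where

  L : ℕ
  L = suc l

  opaque
    next : Fin L → Fin L
    next p = suc (toℕ p) mod L

    toℕ-next : ∀ p → toℕ (next p) ≡ suc (toℕ p) % L
    toℕ-next p = Fin.toℕ-fromℕ< (m%n<n (suc (toℕ p)) L)

  shift : ℕ → Fin L → Fin L
  shift zero p = p
  shift (suc n) p = next (shift n p)

  toℕ-shift : ∀ n p → toℕ (shift n p) ≡ (n + toℕ p) % L
  toℕ-shift zero p = sym (m<n⇒m%n≡m (Fin.toℕ<n p))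
  toℕ-shift (suc n) p = begin
    toℕ (next (shift n p))             ≡⟨ toℕ-next (shift n p) ⟩
    suc (toℕ (shift n p)) % L          ≡⟨ cong (λ x → suc x % L) (toℕ-shift n p) ⟩
    suc ((n + toℕ p) % L) % L          ≡⟨ suc-% (n + toℕ p) L ⟩
    suc (n + toℕ p) % L ∎
    where open ≡-Reasoning

  toℕ-shift-% : ∀ k .{{_ : NonZero k}} → k ∣ L → ∀ n p → toℕ (shift n p) % k ≡ (n + toℕ p) % k
  toℕ-shift-% k k∣L n p = trans (cong (_% k) (toℕ-shift n p)) (m∣n⇒o%n%m≡o%m k L (n + toℕ p) k∣L)

  shift-+ : ∀ m n p → shift (m + n) p ≡ shift m (shift n p)
  shift-+ zero n p = refl
  shift-+ (suc m) n p = cong next (shift-+ m n p)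

  shift-next : ∀ n p → shift n (next p) ≡ next (shift n p)
  shift-next zero p = refl
  shift-next (suc n) p = cong next (shift-next n p)

  shift-comm : ∀ m n p → shift m (shift n p) ≡ shift n (shift m p)
  shift-comm m n p = trans (sym (shift-+ m n p))
    (trans (cong (λ x → shift x p) (+-comm m n)) (shift-+ n m p))

  shift-L : ∀ p → shift L p ≡ p
  shift-L p = Fin.toℕ-injective (begin
    toℕ (shift L p)     ≡⟨ toℕ-shift L p ⟩
    (L + toℕ p) % L     ≡⟨ cong (_% L) (+-comm L (toℕ p)) ⟩
    (toℕ p + L) % L     ≡⟨ [m+n]%n≡m%n (toℕ p) L ⟩
    toℕ p % L           ≡⟨ m<n⇒m%n≡m (Fin.toℕ<n p) ⟩
    toℕ p ∎)
    where open ≡-Reasoning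

  shift-from-0 : ∀ p → shift (toℕ p) zero ≡ p
  shift-from-0 p = Fin.toℕ-injective (begin
    toℕ (shift (toℕ p) zero)   ≡⟨ toℕ-shift (toℕ p) zero ⟩
    (toℕ p + 0) % L            ≡⟨ cong (_% L) (+-identityʳ (toℕ p)) ⟩
    toℕ p % L                  ≡⟨ m<n⇒m%n≡m (Fin.toℕ<n p) ⟩
    toℕ p ∎)
    where open ≡-Reasoning

  shift-l-next : ∀ p → shift l (next p) ≡ p
  shift-l-next p = trans (shift-next l p) (shift-L p)

  next-injective : ∀ {p q} → next p ≡ next q → p ≡ q
  next-injective {p} {q} eq = trans (sym (shift-l-next p)) (trans (cong (shift l) eq) (shift-l-next q))

  -- Step counts leading to the same position are congruent modulo `L`, so unequal ones differ by at
  -- least a whole turn. The lower bounds for tokens that go the wrong way rest on this.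
  shift-≡⇒ : ∀ {a b p} → shift a p ≡ shift b p → a < b → a + L ≤ b
  shift-≡⇒ {a} {b} {p} eq a<b = +-cancelʳ-≤ (toℕ p) (a + L) b (begin
    a + L + toℕ p      ≡⟨ swap a L (toℕ p) ⟩
    a + toℕ p + L      ≤⟨ %-≡-< L congruent (+-monoˡ-< (toℕ p) a<b) ⟩
    b + toℕ p ∎)
    where
    open ≤-Reasoning
    congruent : (a + toℕ p) % L ≡ (b + toℕ p) % L
    congruent = trans (sym (toℕ-shift a p)) (trans (cong toℕ eq) (toℕ-shift b p))
    swap : ∀ x y z → x + y + z ≡ x + z + y
    swap = solve-∀

  sum-shift : (F : Fin L → ℕ) → ∀ j → sum (F ∘ shift j) ≡ sum F
  sum-shift F zero = refl
  sum-shift F (suc j) = begin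
    sum (F ∘ shift (suc j))           ≡⟨ sum-cong-≗ {L} (λ p → cong F (shift-next j p)) ⟨
    sum (F ∘ shift j ∘ next)          ≡⟨ sum-permute {L} (F ∘ shift j) rotation ⟨
    sum (F ∘ shift j)                 ≡⟨ sum-shift F j ⟩
    sum F ∎
    where
    open ≡-Reasoning
    rotation : Permutation′ L
    rotation = Perm.permutation next (shift l) shift-L shift-l-next

  cyclic : List (Fin L) → List (Fin L × Fin L)
  cyclic = map (λ p → p , next p)

  turn : Fin L → Fin L → Fin L
  turn p = PC.transpose p (next p)

  -- Forward and backward steps of the token that starts on `v`: the swap at `p` carries the token
  -- on `p` forward and the one on `next p` backward, and counting goes on from the new position
  -- `turn p v`.
  ups downs moves : List (Fin L) → Fin L → ℕ
  ups [] v = 0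
  ups (p ∷ ps) v = indicator p v + ups ps (turn p v)
  downs [] v = 0
  downs (p ∷ ps) v = indicator (next p) v + downs ps (turn p v)
  moves ps v = ups ps v + downs ps v

  -- Each swap moves exactly one token forward, and `turn p` merely permutes the positions over
  -- which the remaining steps are summed.
  sum-ups : ∀ ps → sum (ups ps) ≡ length ps
  sum-ups [] = sum-zero L
  sum-ups (p ∷ ps) = trans (∑-distrib-+ {L} (indicator p) (ups ps ∘ turn p))
    (cong₂ _+_ (sum-indicator p)
      (trans (sym (sum-permute (ups ps) (Perm.transpose p (next p)))) (sum-ups ps)))

  sum-downs : ∀ ps → sum (downs ps) ≡ length ps
  sum-downs [] = sum-zero L
  sum-downs (p ∷ ps) = trans (∑-distrib-+ {L} (indicator (next p)) (downs ps ∘ turn p))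
    (cong₂ _+_ (sum-indicator (next p))
      (trans (sym (sum-permute (downs ps) (Perm.transpose p (next p)))) (sum-downs ps)))

  module _ (1≤l : 1 ≤ l) where

    next≢ : ∀ p → next p ≢ p
    next≢ p eq = <⇒≱ (s≤s 1≤l) (shift-≡⇒ {0} {1} {p} (sym eq) (s≤s z≤n))

    -- Modulo `L`, the end is the start plus the forward steps minus the backward steps. The
    -- backward steps are added to the end because `shift` only goes forward.
    shift-ups≡shift-downs : ∀ ps v → shift (ups ps v) v ≡ shift (downs ps v) (track (cyclic ps) v)
    shift-ups≡shift-downs [] v = sym (track-[] v)
    shift-ups≡shift-downs (p ∷ ps) v = by-cases (v Fin.≟ p) (v Fin.≟ next p)
      where
      by-cases : Dec (v ≡ p) → Dec (v ≡ next p) →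
        shift (ups (p ∷ ps) v) v ≡ shift (downs (p ∷ ps) v) (track (cyclic (p ∷ ps)) v)
      after : ∀ d {w} → turn p v ≡ w → shift d (track (cyclic ps) w) ≡ shift d (track (cyclic (p ∷ ps)) v)
      after d eq = cong (shift d) (sym (track-∷ p (next p) (cyclic ps) eq))
      by-cases (yes refl) _
        rewrite indicator-yes p | indicator-no (next≢ p ∘ sym) | transpose-fst p (next p)
        = trans (sym (shift-next (ups ps (next p)) p)) (trans (shift-ups≡shift-downs ps (next p))
            (after (downs ps (next p)) (transpose-fst p (next p))))
      by-cases (no _) (yes refl)
        rewrite indicator-no (next≢ p) | indicator-yes (next p) | transpose-snd p (next p)
        = trans (shift-next (ups ps p) p) (trans (cong next (shift-ups≡shift-downs ps p))
            (after (suc (downs ps p)) (transpose-snd p (next p))))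
      by-cases (no v≢p) (no v≢next)
        rewrite indicator-no v≢p | indicator-no v≢next | transpose-other v≢p v≢next
        = trans (shift-ups≡shift-downs ps v) (after (downs ps v) (transpose-other v≢p v≢next))

    -- A token that never moves cannot be overtaken.
    unmoved-blocks : ∀ ps {h} → moves ps h ≡ 0 → ∀ r {v} → shift (suc r) v ≡ h → ups ps v ≤ r + downs ps v
    unmoved-blocks [] _ r _ = z≤n
    unmoved-blocks (p ∷ ps) {h} h-unmoved r {v} v→h = by-cases (v Fin.≟ p) (v Fin.≟ next p)
      where
      unhit : moves (p ∷ ps) h ≡ 0 → h ≢ p × h ≢ next p
      unhit eq =
          (λ { refl → 1+n≢0 (trans (sym (indicator-yes p))
            (m+n≡0⇒m≡0 _ (m+n≡0⇒m≡0 (ups (p ∷ ps) p) eq))) })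
        , (λ { refl → 1+n≢0 (trans (sym (indicator-yes (next p)))
            (m+n≡0⇒m≡0 _ (m+n≡0⇒n≡0 (ups (p ∷ ps) (next p)) eq))) })
      h≢p = proj₁ (unhit h-unmoved)
      h≢next = proj₂ (unhit h-unmoved)
      still-unmoved : moves (p ∷ ps) h ≡ 0 → moves ps h ≡ 0
      still-unmoved eq
        rewrite indicator-no h≢p | indicator-no h≢next | transpose-other h≢p h≢next = eq
      h-unmoved′ : moves ps h ≡ 0
      h-unmoved′ = still-unmoved h-unmoved
      forward : ∀ r → shift (suc r) p ≡ h → suc (ups ps (next p)) ≤ r + downs ps (next p)
      -- With no room left, `next p` is `h` itself, and this swap would move it.
      forward zero eq = contradiction (sym eq) h≢next
      forward (suc r) eq = s≤s (unmoved-blocks ps h-unmoved′ r (trans (shift-next (suc r) p) eq))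
      by-cases : Dec (v ≡ p) → Dec (v ≡ next p) → ups (p ∷ ps) v ≤ r + downs (p ∷ ps) v
      by-cases (yes refl) _
        rewrite indicator-yes p | indicator-no (next≢ p ∘ sym) | transpose-fst p (next p)
        = forward r v→h
      by-cases (no _) (yes refl)
        rewrite indicator-no (next≢ p) | indicator-yes (next p) | transpose-snd p (next p)
        = ≤-trans (unmoved-blocks ps h-unmoved′ (suc r) (trans (sym (shift-next (suc r) p)) v→h))
                  (≤-reflexive (sym (+-suc r _)))
      by-cases (no v≢p) (no v≢next)
        rewrite indicator-no v≢p | indicator-no v≢next | transpose-other v≢p v≢next
        = unmoved-blocks ps h-unmoved′ r v→h

-- Lower bound for the swaps on one cycle.

-- m = suc m′ travelling tokens, at distance k = suc k′ from each other.
module CycleBound (m′ k′ : ℕ) (3≤m′ : 3 ≤ m′) where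

  k : ℕ
  k = suc k′

  -- This makes `L` unfold to `suc m′ * k`, one stretch of length `k` per traveller.
  open Cycle (k′ + m′ * k) public

  1≤l : 1 ≤ k′ + m′ * k
  1≤l = ≤-trans (≤-trans (s≤s z≤n) (*-mono-≤ 3≤m′ (s≤s z≤n))) (m≤n+m (m′ * k) k′)

  k∣L : k ∣ L
  k∣L = divides (suc m′) refl

  module _ (j : ℕ) (ps : List (Fin L))
    (travels : ∀ p → toℕ p % k ≡ j % k → track (cyclic ps) p ≡ shift k p)
    (stays : ∀ p → toℕ p % k ≢ j % k → track (cyclic ps) p ≡ p) where

    travel-congruence : ∀ p → toℕ p % k ≡ j % k → shift (ups ps p) p ≡ shift (downs ps p + k) p
    travel-congruence p p∈ = trans (shift-ups≡shift-downs 1≤l ps p)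
      (trans (cong (shift (downs ps p)) (travels p p∈)) (sym (shift-+ (downs ps p) k p)))

    stay-congruence : ∀ p → toℕ p % k ≢ j % k → shift (ups ps p) p ≡ shift (downs ps p) p
    stay-congruence p p∉ = trans (shift-ups≡shift-downs 1≤l ps p) (cong (shift (downs ps p)) (stays p p∉))

    -- The net displacement of a traveller is congruent to `k` modulo `L`. If it is below `k`, it is
    -- at most `k - L`, which is minus `m′ * k`.
    long : ∀ p → toℕ p % k ≡ j % k → ups ps p < downs ps p + k → m′ * k ≤ downs ps p
    long p p∈ u< = +-cancelˡ-≤ k _ _ (begin
      L                   ≤⟨ m≤n+m L (ups ps p) ⟩
      ups ps p + L        ≤⟨ shift-≡⇒ (travel-congruence p p∈) u< ⟩
      downs ps p + k      ≡⟨ +-comm (downs ps p) k ⟩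
      k + downs ps p ∎)
      where open ≤-Reasoning

    -- The net displacement is congruent to `k` for a traveller and to 0 for a token at home, so a
    -- negative one is at most `k - L` in both cases.
    long-of-negative : ∀ p → ups ps p < downs ps p → m′ * k ≤ moves ps p
    long-of-negative p u<d with toℕ p % k ℕ.≟ j % k
    ... | yes p∈ = ≤-trans (long p p∈ (<-≤-trans u<d (m≤m+n _ k))) (m≤n+m _ (ups ps p))
    ... | no p∉ = begin
      m′ * k                 ≤⟨ m≤n+m (m′ * k) k ⟩
      L                      ≤⟨ m≤n+m L (ups ps p) ⟩
      ups ps p + L           ≤⟨ shift-≡⇒ (stay-congruence p p∉) u<d ⟩
      downs ps p             ≤⟨ m≤n+m _ (ups ps p) ⟩
      moves ps p ∎
      where open ≤-Reasoning

    -- Either the net displacement is at least `k`, or the traveller takes the long way, which is no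
    -- shorter.
    k≤moves : ∀ p → toℕ p % k ≡ j % k → k ≤ moves ps p
    k≤moves p p∈ with ups ps p <? downs ps p + k
    ... | yes u< = ≤-trans (≤-trans (m≤n*m k m′ {{>-nonZero (≤-trans (s≤s z≤n) 3≤m′)}}) (long p p∈ u<))
      (m≤n+m _ (ups ps p))
    ... | no u≮ = ≤-trans (≤-trans (m≤n+m k (downs ps p)) (≮⇒≥ u≮)) (m≤m+n (ups ps p) _)

    -- A token that returns home either makes as many forward as backward steps, an even number in
    -- total, or goes round the whole cycle.
    2≤moves : ∀ p → toℕ p % k ≢ j % k → moves ps p ≢ 0 → 2 ≤ moves ps p
    2≤moves p p∉ moved with <-cmp (ups ps p) (downs ps p)
    ... | tri< u<d _ _ = begin
      2                      ≤⟨ s≤s 1≤l ⟩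
      L                      ≤⟨ m≤n+m L (ups ps p) ⟩
      ups ps p + L           ≤⟨ shift-≡⇒ (stay-congruence p p∉) u<d ⟩
      downs ps p             ≤⟨ m≤n+m _ (ups ps p) ⟩
      moves ps p ∎
      where open ≤-Reasoning
    ... | tri> _ _ d<u = begin
      2                      ≤⟨ s≤s 1≤l ⟩
      L                      ≤⟨ m≤n+m L (downs ps p) ⟩
      downs ps p + L         ≤⟨ shift-≡⇒ (sym (stay-congruence p p∉)) d<u ⟩
      ups ps p               ≤⟨ m≤m+n _ (downs ps p) ⟩
      moves ps p ∎
      where open ≤-Reasoning
    ... | tri≈ _ u≡d _ with ups ps p | downs ps p
    2≤moves p p∉ moved | tri≈ _ refl _ | zero | _ = contradiction refl moved
    2≤moves p p∉ moved | tri≈ _ refl _ | suc u | _ = s≤s (≤-trans (s≤s z≤n) (m≤n+m (suc u) u))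

    -- For `s` in the class of `j`, this covers the traveller on `s` and the `k′` tokens at home
    -- between it and the next traveller.
    arc : Fin L → ℕ
    arc s = sum {k} (λ i → moves ps (shift (toℕ i) s))

    off-class : ∀ {s} → toℕ s % k ≡ j % k → (i : Fin k′) → toℕ (shift (suc (toℕ i)) s) % k ≢ j % k
    off-class {s} s∈ i eq = <⇒≱ (s≤s (Fin.toℕ<n i)) (+-cancelʳ-≤ (toℕ s) _ _
      (≤-trans (≤-reflexive (+-comm k (toℕ s)))
        (%-≡-< k (trans s∈ (trans (sym eq) (toℕ-shift-% k k∣L (suc (toℕ i)) s)))
          (s≤s (m≤n+m (toℕ s) (toℕ i))))))

    -- A traveller blocked by an unmoved token at home has to go the long way round the cycle.
    arc-bound : ∀ s → toℕ s % k ≡ j % k → 1 + 3 * k′ ≤ arc s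
    arc-bound s s∈ with Fin.any? (λ (i : Fin k′) → moves ps (shift (suc (toℕ i)) s) ℕ.≟ 0)
    ... | yes (i , unmoved) = begin
      1 + 3 * k′             ≤⟨ s≤s (m≤n+m (3 * k′) 2) ⟩
      3 + 3 * k′             ≡⟨ *-suc 3 k′ ⟨
      3 * k                  ≤⟨ *-monoˡ-≤ k 3≤m′ ⟩
      m′ * k                 ≤⟨ long s s∈ blocked ⟩
      downs ps s             ≤⟨ m≤n+m _ (ups ps s) ⟩
      moves ps s             ≤⟨ m≤m+n (moves ps s) _ ⟩
      arc s ∎
      where
      open ≤-Reasoning
      blocked : ups ps s < downs ps s + k
      blocked = begin-strict
        ups ps s             ≤⟨ unmoved-blocks 1≤l ps unmoved (toℕ i) refl ⟩
        toℕ i + downs ps s   <⟨ +-monoˡ-< (downs ps s) (m≤n⇒m≤1+n (Fin.toℕ<n i)) ⟩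
        k + downs ps s       ≡⟨ +-comm k (downs ps s) ⟩
        downs ps s + k ∎
    -- The traveller makes at least `k` moves and each of the `k′` tokens at home at least two.
    ... | no all-moved = begin
      1 + 3 * k′             ≡⟨ regroup k′ ⟩
      k + k′ * 2             ≡⟨ cong (_+_ k) (sum-const k′ 2) ⟨
      k + sum {k′} (λ _ → 2) ≤⟨ +-mono-≤ (k≤moves s s∈)
                                 (sum-mono (λ i → 2≤moves _ (off-class s∈ i) (all-moved ∘ (i ,_)))) ⟩
      arc s ∎
      where
      open ≤-Reasoning
      regroup : ∀ x → 1 + 3 * x ≡ suc x + x * 2
      regroup = solve-∀

    base : Fin L
    base = shift j zero

    -- The start of the `a`-th traveller, counted from the one on `base`.
    origin : ℕ → Fin L
    origin a = shift (a * k) base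

    origin∈ : ∀ a → toℕ (origin a) % k ≡ j % k
    origin∈ a = begin
      toℕ (origin a) % k          ≡⟨ toℕ-shift-% k k∣L (a * k) base ⟩
      (a * k + toℕ base) % k     ≡⟨ cong (_% k) (+-comm (a * k) (toℕ base)) ⟩
      (toℕ base + a * k) % k     ≡⟨ [m+kn]%n≡m%n (toℕ base) a k ⟩
      toℕ base % k               ≡⟨ toℕ-shift-% k k∣L j zero ⟩
      (j + 0) % k                ≡⟨ cong (_% k) (+-identityʳ j) ⟩
      j % k ∎
      where open ≡-Reasoning

    sum-from-base : (F : Fin L → ℕ) → sum F ≡ sum {L} (λ p → F (shift (toℕ p) base))
    sum-from-base F = trans (sym (sum-shift F j)) (sum-cong-≗ {L} (λ p → cong F
      (trans (cong (shift j) (sym (shift-from-0 p))) (shift-comm j (toℕ p) zero))))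

    shift-origin : ∀ a i → shift (a * k + i) base ≡ shift i (origin a)
    shift-origin a i = trans (shift-+ (a * k) i base) (shift-comm (a * k) i base)

    sum-by-arcs : sum (moves ps) ≡ sum {suc m′} (λ a → arc (origin (toℕ a)))
    sum-by-arcs = trans (sum-from-base (moves ps))
      (trans (sum-toℕ-* (suc m′) k (λ x → moves ps (shift x base)))
      (sum-cong-≗ {suc m′} (λ a → sum-cong-≗ {k} (λ i → cong (moves ps) (shift-origin (toℕ a) (toℕ i))))))

    -- The displacements of all tokens sum to zero and those of the travelling ones do not vanish.
    negative : ∃ λ (q : Fin (suc m′ * k)) → ups ps (shift (toℕ q) base) < downs ps (shift (toℕ q) base)
    negative = sum≡⇒∃< (trans (sym (sum-from-base (ups ps))) (trans (sum-ups ps)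
        (trans (sym (sum-downs ps)) (sum-from-base (downs ps))))) zero
      -- The token whose two counts differ is the traveller on `base`: with equal counts, its
      -- displacement `k` would force `L` to be at most `k`.
      (λ u≡d → <⇒≱ (m<m+n k (≤-trans (s≤s z≤n) (*-mono-≤ 3≤m′ (s≤s z≤n))))
        (+-cancelˡ-≤ (downs ps base) _ _
          (≤-trans (≤-reflexive (cong (_+ L) (sym u≡d)))
            (shift-≡⇒ (travel-congruence base (origin∈ 0)) (≤-<-trans (≤-reflexive u≡d) (m<m+n _ (s≤s z≤n)))))))

    some-long-arc : ∃ λ (a : Fin (suc m′)) → m′ * k ≤ arc (origin (toℕ a))
    some-long-arc with negative
    ... | q , u<d with Fin.combine-surjective {suc m′} {k} q
    ...   | a , i , refl = a , ≤-trans (long-of-negative _ u<d) (≤-trans (≤-reflexive (cong (moves ps)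
            (trans (cong (λ x → shift x base) (trans (Fin.toℕ-combine a i) (cong (_+ toℕ i) (*-comm k (toℕ a)))))
              (shift-origin (toℕ a) (toℕ i)))))
          (sum-≥-single {k} (λ i → moves ps (shift (toℕ i) (origin (toℕ a)))) i))

    -- Every swap makes two moves, so twice the length is the sum over the arcs. One arc contains a
    -- token of negative net displacement and has at least `m′ * k` moves; the other `m′` arcs have
    -- at least `1 + 3 * k′` each.
    cycle-bound : m′ * (1 + 2 * k′) ≤ length ps
    cycle-bound = *-cancelˡ-≤ 2 (begin
      2 * (m′ * (1 + 2 * k′))           ≡⟨ regroup m′ k′ ⟩
      m′ * k + m′ * (1 + 3 * k′)        ≤⟨ arcs-bound ⟩
      sum {suc m′} (λ a → arc (origin (toℕ a)))   ≡⟨ sum-by-arcs ⟨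
      sum (moves ps)                    ≡⟨ ∑-distrib-+ {L} (ups ps) (downs ps) ⟩
      sum (ups ps) + sum (downs ps)     ≡⟨ cong₂ _+_ (sum-ups ps) (sum-downs ps) ⟩
      length ps + length ps             ≡⟨ cong (_+_ (length ps)) (+-identityʳ (length ps)) ⟨
      2 * length ps ∎)
      where
      open ≤-Reasoning
      arcs-bound : m′ * k + m′ * (1 + 3 * k′) ≤ sum {suc m′} (λ a → arc (origin (toℕ a)))
      arcs-bound with some-long-arc
      ... | a , long-arc = sum-≥-exceptional {m′} (λ a → arc (origin (toℕ a))) (1 + 3 * k′) (m′ * k)
        (λ a → arc-bound _ (origin∈ (toℕ a))) a long-arc
      regroup : ∀ x y → 2 * (x * (1 + 2 * y)) ≡ x * suc y + x * (1 + 3 * y)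
      regroup = solve-∀

-- Parity, the product graph and its connectedness.

suc-%2-even : ∀ m → m % 2 ≡ 0 → suc m % 2 ≢ 0
suc-%2-even m eq eq′ with () ← trans (sym (trans (sym (suc-% m 2)) (cong (λ x → suc x % 2) eq))) eq′

suc-%2-odd : ∀ m → m % 2 ≢ 0 → suc m % 2 ≡ 0
suc-%2-odd m m-odd with m % 2 in eq | m%n<n m 2
... | zero | _ = contradiction refl m-odd
... | suc zero | _ = trans (sym (suc-% m 2)) (cong (λ x → suc x % 2) eq)
... | suc (suc _) | s≤s (s≤s ())

length-filter-¬ : ∀ {A : Set} {P : A → Set} (P? : ∀ x → Dec (P x)) xs →
  length (filter P? xs) + length (filter (¬? ∘ P?) xs) ≡ length xs
length-filter-¬ P? [] = refl
length-filter-¬ P? (x ∷ xs) with P? x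
... | yes _ = cong suc (length-filter-¬ P? xs)
... | no _ = trans (+-suc _ _) (cong suc (length-filter-¬ P? xs))

module Construction (k′ κ : ℕ) (k≡κ*2 : suc k′ ≡ κ * 2) (3≤k′ : 3 ≤ k′) where

  -- With `m′ = k′` there are `k` travellers on a cycle of length `k * k`.
  open CycleBound k′ k′ 3≤k′

  N : ℕ
  N = suc k

  |V| : ℕ
  |V| = N * L

  opaque
    vertex : Fin N → Fin L → Fin |V|
    vertex = combine

    layer : Fin |V| → Fin N
    layer u = proj₁ (remQuot {N} L u)

    pos : Fin |V| → Fin L
    pos u = proj₂ (remQuot {N} L u)

    vertex-layer-pos : ∀ u → vertex (layer u) (pos u) ≡ u
    vertex-layer-pos u = Fin.combine-remQuot {N} L u

    layer-vertex : ∀ i p → layer (vertex i p) ≡ i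
    layer-vertex i p = cong proj₁ (Fin.remQuot-combine {N} {L} i p)

    pos-vertex : ∀ i p → pos (vertex i p) ≡ p
    pos-vertex i p = cong proj₂ (Fin.remQuot-combine {N} {L} i p)

  layer-injective : ∀ {i j p q} → vertex i p ≡ vertex j q → i ≡ j
  layer-injective {i} {j} {p} {q} eq = trans (sym (layer-vertex i p)) (trans (cong layer eq) (layer-vertex j q))

  pos-injective : ∀ {i j p q} → vertex i p ≡ vertex j q → p ≡ q
  pos-injective {i} {j} {p} {q} eq = trans (sym (pos-vertex i p)) (trans (cong pos eq) (pos-vertex j q))

  layer≢ : ∀ {i j p q} → i ≢ j → vertex i p ≢ vertex j q
  layer≢ i≢j = i≢j ∘ layer-injective

  pos≢ : ∀ {i j p q} → p ≢ q → vertex i p ≢ vertex j q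
  pos≢ p≢q = p≢q ∘ pos-injective

  -- The graph is K_{k+1} □ C_L; layer 0 is the hub.
  data Edge (u v : Fin |V|) : Set where
    fibre : layer u ≢ layer v → pos u ≡ pos v → Edge u v
    forward : layer u ≡ layer v → pos v ≡ next (pos u) → Edge u v
    backward : layer u ≡ layer v → pos u ≡ next (pos v) → Edge u v

  edge? : ∀ u v → Dec (Edge u v)
  edge? u v with layer u ≟ layer v
  ... | no l≢ with pos u ≟ pos v
  ...   | yes p≡ = yes (fibre l≢ p≡)
  ...   | no p≢ = no λ { (fibre _ p≡) → p≢ p≡ ; (forward l≡ _) → l≢ l≡ ; (backward l≡ _) → l≢ l≡ }
  edge? u v | yes l≡ with pos v ≟ next (pos u) | pos u ≟ next (pos v)
  ... | yes p≡ | _ = yes (forward l≡ p≡)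
  ... | no _ | yes p≡ = yes (backward l≡ p≡)
  ... | no ¬f | no ¬b = no λ { (fibre l≢ _) → l≢ l≡ ; (forward _ p≡) → ¬f p≡ ; (backward _ p≡) → ¬b p≡ }

  Edge-sym : ∀ {u v} → Edge u v → Edge v u
  Edge-sym (fibre l≢ p≡) = fibre (l≢ ∘ sym) (sym p≡)
  Edge-sym (forward l≡ p≡) = backward (sym l≡) p≡
  Edge-sym (backward l≡ p≡) = forward (sym l≡) p≡

  opaque
    adj : Fin |V| → Fin |V| → Bool
    adj u v = does (edge? u v)

    Edge⇒adj : ∀ {u v} → Edge u v → T (adj u v)
    Edge⇒adj {u} {v} e rewrite dec-true (edge? u v) e = _

    adj⇒Edge : ∀ {u v} → T (adj u v) → Edge u v
    adj⇒Edge {u} {v} t with edge? u v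
    ... | yes e = e

    adj-sym : ∀ u v → adj u v ≡ adj v u
    adj-sym u v = does-⇔ (mk⇔ Edge-sym Edge-sym) (edge? u v) (edge? v u)

  adj-irrefl : ∀ u → ¬ T (adj u u)
  adj-irrefl u e with adj⇒Edge e
  ... | fibre l≢ _ = l≢ refl
  ... | forward _ p≡ = next≢ 1≤l (pos u) (sym p≡)
  ... | backward _ p≡ = next≢ 1≤l (pos u) (sym p≡)

  fibre-edge : ∀ {i j} p → i ≢ j → Edge (vertex i p) (vertex j p)
  fibre-edge {i} {j} p i≢j = fibre
    (λ eq → i≢j (trans (sym (layer-vertex i p)) (trans eq (layer-vertex j p))))
    (trans (pos-vertex i p) (sym (pos-vertex j p)))

  cycle-edge : ∀ i p → Edge (vertex i p) (vertex i (next p))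
  cycle-edge i p = forward (trans (layer-vertex i p) (sym (layer-vertex i (next p))))
    (trans (pos-vertex i (next p)) (cong next (sym (pos-vertex i p))))

  Connected : Fin |V| → Fin |V| → Set
  Connected u v = ∃ λ d → Walk adj u v d

  connected-trans : ∀ {u v x} → Connected u v → Connected v x → Connected u x
  connected-trans (_ , here) w′ = w′
  connected-trans (_ , step e w) w′ with connected-trans (_ , w) w′
  ... | _ , w″ = _ , step e w″

  connected-edge : ∀ {u v} → Edge u v → Connected u v
  connected-edge e = 1 , step (Edge⇒adj e) here

  connected-sym : ∀ {u v} → Connected u v → Connected v u
  connected-sym (_ , here) = 0 , here
  connected-sym (_ , step {u} {v} e w) =
    connected-trans (connected-sym (_ , w)) (connected-edge (Edge-sym (adj⇒Edge e)))

  connected-shift : ∀ i r p → Connected (vertex i p) (vertex i (shift r p))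
  connected-shift i zero p = 0 , here
  connected-shift i (suc r) p = connected-trans (connected-shift i r p) (connected-edge (cycle-edge i _))

  connected-hub : ∀ u → Connected (vertex zero zero) u
  connected-hub u = subst (Connected _) (vertex-layer-pos u)
    (connected-trans to-layer (subst (λ p → Connected (vertex (layer u) zero) (vertex (layer u) p))
      (shift-from-0 (pos u)) (connected-shift (layer u) (toℕ (pos u)) zero)))
    where
    to-layer : Connected (vertex zero zero) (vertex (layer u) zero)
    to-layer with zero ≟ layer u
    ... | yes eq = subst (λ i → Connected (vertex zero zero) (vertex i zero)) eq (0 , here)
    ... | no neq = connected-edge (fibre-edge zero neq)

  connected : ∀ u v → Connected u v
  connected u v = connected-trans (connected-sym (connected-hub u)) (connected-hub v)

  -- A short solution through the hub.

  2∣k : 2 ∣ k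
  2∣k = divides κ k≡κ*2

  2∣L : 2 ∣ L
  2∣L = ∣-trans 2∣k k∣L

  -- The travellers of layer `suc i` start on the positions of class `i`. Thus each position carries
  -- a traveller in exactly one layer, and all travellers fit into the hub at once.
  class : Fin L → Fin k
  class p = toℕ p mod k

  toℕ-class : ∀ p → toℕ (class p) ≡ toℕ p % k
  toℕ-class p = Fin.toℕ-fromℕ< (m%n<n (toℕ p) k)

  class-shift-k : ∀ p → class (shift k p) ≡ class p
  class-shift-k p = Fin.toℕ-injective (begin
    toℕ (class (shift k p))    ≡⟨ toℕ-class (shift k p) ⟩
    toℕ (shift k p) % k        ≡⟨ toℕ-shift-% k k∣L k p ⟩
    (k + toℕ p) % k            ≡⟨ cong (_% k) (+-comm k (toℕ p)) ⟩
    (toℕ p + k) % k            ≡⟨ [m+n]%n≡m%n (toℕ p) k ⟩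
    toℕ p % k                  ≡⟨ toℕ-class p ⟨
    toℕ (class p) ∎)
    where open ≡-Reasoning

  Even : Fin L → Set
  Even p = toℕ p % 2 ≡ 0

  even? : ∀ p → Dec (Even p)
  even? p = toℕ p % 2 ℕ.≟ 0

  -- As `L` is even, parity alternates all the way round the cycle. Hence the edges that start at
  -- even positions form a perfect matching, and so do the others.
  next-even : ∀ {p} → Even p → ¬ Even (next p)
  next-even {p} p-even eq = suc-%2-even (toℕ p) p-even (trans (sym (toℕ-shift-% 2 2∣L 1 p)) eq)

  next-odd : ∀ {p} → ¬ Even p → Even (next p)
  next-odd {p} p-odd = trans (toℕ-shift-% 2 2∣L 1 p) (suc-%2-odd (toℕ p) p-odd)

  module Fibres = Matching (vertex zero) (λ p → vertex (suc (class p)) p)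
  module HubEdges = Matching (vertex zero) (vertex zero ∘ next)

  evens odds : List (Fin L)
  evens = filter even? (allFin L)
  odds = filter (¬? ∘ even?) (allFin L)

  exchange E O : List (Fin |V| × Fin |V|)
  exchange = Fibres.swaps (allFin L)
  E = HubEdges.swaps evens
  O = HubEdges.swaps odds

  -- A round moves the tokens at even hub positions two steps forward and the others two steps back.
  rounds : ℕ → List (Fin |V| × Fin |V|)
  rounds zero = []
  rounds (suc r) = (E ++ O) ++ rounds r

  -- The first exchange brings all travellers into the hub and parks the hub tokens in their places,
  -- the `κ` rounds move each traveller by `κ * 2 = k` positions, and the second exchange brings
  -- everything back.
  solution : List (Fin |V| × Fin |V|)
  solution = exchange ++ (rounds κ ++ exchange)

  zero≢suc : ∀ {m} {i : Fin m} → Fin.zero ≢ suc i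
  zero≢suc ()

  exchange-matched : ∀ p → track exchange (vertex zero p) ≡ vertex (suc (class p)) p
                         × track exchange (vertex (suc (class p)) p) ≡ vertex zero p
  exchange-matched p = Fibres.track-matched (allFin L) (Unique.allFin⁺ L)
    (λ _ _ p≢q → (pos≢ p≢q , pos≢ p≢q) , (pos≢ p≢q , pos≢ p≢q)) (∈-allFin p)

  exchange-unmatched : ∀ {i p} → i ≢ class p → track exchange (vertex (suc i) p) ≡ vertex (suc i) p
  exchange-unmatched {i} {p} i≢ = Fibres.track-unmatched (allFin L) λ {q} _ →
    layer≢ (zero≢suc ∘ sym) , λ eq → i≢ (trans (Fin.suc-injective (layer-injective eq))
      (cong class (sym (pos-injective eq))))

  -- A shared end of two such edges would make one starting position the successor of the other,
  -- although `P` never holds at two consecutive positions.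
  hub-disjoint : ∀ {P : Fin L → Set} → (∀ {p} → P p → ¬ P (next p)) → ∀ {p q} → P p → P q → p ≢ q →
    HubEdges.Disjoint p q
  hub-disjoint {P} alternates {p} {q} Pp Pq p≢q =
      (pos≢ p≢q , pos≢ λ { refl → alternates Pq Pp })
    , (pos≢ (λ { refl → alternates Pp Pq }) , pos≢ (p≢q ∘ next-injective))

  E-matched : ∀ {p} → Even p → track E (vertex zero p) ≡ vertex zero (next p)
                             × track E (vertex zero (next p)) ≡ vertex zero p
  E-matched {p} p-even = HubEdges.track-matched evens (Unique.filter⁺ even? (Unique.allFin⁺ L))
    (λ p∈ q∈ → hub-disjoint {Even} next-even
      (proj₂ (∈-filter⁻ even? {xs = allFin L} p∈)) (proj₂ (∈-filter⁻ even? {xs = allFin L} q∈)))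
    (∈-filter⁺ even? (∈-allFin p) p-even)

  O-matched : ∀ {p} → ¬ Even p → track O (vertex zero p) ≡ vertex zero (next p)
                               × track O (vertex zero (next p)) ≡ vertex zero p
  O-matched {p} p-odd = HubEdges.track-matched odds (Unique.filter⁺ odd? (Unique.allFin⁺ L))
    (λ p∈ q∈ → hub-disjoint {¬_ ∘ Even} (λ odd ¬even → ¬even (next-odd odd))
      (proj₂ (∈-filter⁻ odd? {xs = allFin L} p∈)) (proj₂ (∈-filter⁻ odd? {xs = allFin L} q∈)))
    (∈-filter⁺ odd? (∈-allFin p) p-odd)
    where
    odd? : ∀ p → Dec (¬ Even p)
    odd? = ¬? ∘ even?

  hub-swaps-elsewhere : ∀ ps i p → track (HubEdges.swaps ps) (vertex (suc i) p) ≡ vertex (suc i) p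
  hub-swaps-elsewhere ps i p = HubEdges.track-unmatched ps λ _ →
    layer≢ (zero≢suc ∘ sym) , layer≢ (zero≢suc ∘ sym)

  EO-even : ∀ {p} → Even p → track (E ++ O) (vertex zero p) ≡ vertex zero (shift 2 p)
  EO-even {p} p-even = trans (track-++ E O _) (trans (cong (track O) (proj₁ (E-matched p-even)))
    (proj₁ (O-matched (next-even p-even))))

  -- Backward movement is stated from the position where it ends, since `shift` only goes forward.
  EO-odd : ∀ {p} → ¬ Even p → track (E ++ O) (vertex zero (shift 2 p)) ≡ vertex zero p
  EO-odd p-odd = trans (track-++ E O _) (trans (cong (track O) (proj₂ (E-matched (next-odd p-odd))))
    (proj₂ (O-matched p-odd)))

  rounds-even : ∀ r {p} → Even p → track (rounds r) (vertex zero p) ≡ vertex zero (shift (r * 2) p)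
  rounds-even zero p-even = track-[] _
  rounds-even (suc r) {p} p-even = begin
    track ((E ++ O) ++ rounds r) (vertex zero p)       ≡⟨ track-++ (E ++ O) (rounds r) _ ⟩
    track (rounds r) (track (E ++ O) (vertex zero p))  ≡⟨ cong (track (rounds r)) (EO-even p-even) ⟩
    track (rounds r) (vertex zero (shift 2 p))         ≡⟨ rounds-even r (next-odd (next-even p-even)) ⟩
    vertex zero (shift (r * 2) (shift 2 p))            ≡⟨ cong (vertex zero) (shift-comm (r * 2) 2 p) ⟩
    vertex zero (shift (suc r * 2) p) ∎
    where open ≡-Reasoning

  odd-shift : ∀ r {p} → ¬ Even p → ¬ Even (shift (r * 2) p)
  odd-shift zero p-odd = p-odd
  odd-shift (suc r) p-odd = next-even (next-odd (odd-shift r p-odd))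

  rounds-odd : ∀ r {p} → ¬ Even p → track (rounds r) (vertex zero (shift (r * 2) p)) ≡ vertex zero p
  rounds-odd zero p-odd = track-[] _
  rounds-odd (suc r) {p} p-odd = trans (track-++ (E ++ O) (rounds r) _)
    (trans (cong (track (rounds r)) (EO-odd (odd-shift r p-odd))) (rounds-odd r p-odd))

  rounds-elsewhere : ∀ r i p → track (rounds r) (vertex (suc i) p) ≡ vertex (suc i) p
  rounds-elsewhere zero i p = track-[] _
  rounds-elsewhere (suc r) i p = trans (track-++ (E ++ O) (rounds r) _) (trans (cong (track (rounds r))
    (trans (track-++ E O _) (trans (cong (track O) (hub-swaps-elsewhere evens i p))
      (hub-swaps-elsewhere odds i p))))
    (rounds-elsewhere r i p))

  track-solution : ∀ {u v x y} →
    track exchange u ≡ v → track (rounds κ) v ≡ x → track exchange x ≡ y → track solution u ≡ y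
  track-solution {u} refl refl refl = trans (track-++ exchange _ u) (track-++ (rounds κ) exchange _)

  solution-hub : ∀ p → track solution (vertex zero p) ≡ vertex zero p
  solution-hub p = track-solution (proj₁ (exchange-matched p)) (rounds-elsewhere κ _ p)
    (proj₂ (exchange-matched p))

  solution-stay : ∀ {i p} → i ≢ class p → track solution (vertex (suc i) p) ≡ vertex (suc i) p
  solution-stay i≢ = track-solution (exchange-unmatched i≢) (rounds-elsewhere κ _ _) (exchange-unmatched i≢)

  -- A traveller moved by `k` keeps its class, so the second exchange returns it to the layer it
  -- came from.
  rejoin : ∀ p → vertex (suc (class (shift k p))) (shift k p) ≡ vertex (suc (class p)) (shift k p)
  rejoin p = cong (λ i → vertex (suc i) (shift k p)) (class-shift-k p)

  solution-even : ∀ {p} → Even p →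
    track solution (vertex (suc (class p)) p) ≡ vertex (suc (class p)) (shift k p)
  solution-even {p} p-even = track-solution (proj₂ (exchange-matched p))
    (trans (rounds-even κ p-even) (cong (λ r → vertex zero (shift r p)) (sym k≡κ*2)))
    (trans (proj₁ (exchange-matched (shift k p))) (rejoin p))

  solution-odd : ∀ {p} → ¬ Even p →
    track solution (vertex (suc (class p)) (shift k p)) ≡ vertex (suc (class p)) p
  solution-odd {p} p-odd = track-solution
    (trans (cong (track exchange) (sym (rejoin p))) (proj₂ (exchange-matched (shift k p))))
    (trans (cong (λ r → track (rounds κ) (vertex zero (shift r p))) k≡κ*2) (rounds-odd κ p-odd))
    (proj₁ (exchange-matched p))

  -- Since `k′ * k` is `L - k`, this is the shift backwards by `k`; it finds the destination of a
  -- backward traveller.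
  unshift-k : Fin L → Fin L
  unshift-k = shift (k′ * k)

  shift-unshift-k : ∀ p → shift k (unshift-k p) ≡ p
  shift-unshift-k p = trans (sym (shift-+ k (k′ * k) p)) (shift-L p)

  Even-shift-k : ∀ {p} → Even p → Even (shift k p)
  Even-shift-k {p} eq = trans (toℕ-shift-% 2 2∣L k p) (trans (%-remove-+ˡ (toℕ p) 2∣k) eq)

  solution-layer-vertex : ∀ i p → layer (track solution (vertex i p)) ≡ i
  solution-layer-vertex zero p = trans (cong layer (solution-hub p)) (layer-vertex zero p)
  solution-layer-vertex (suc i) p with i ≟ class p
  ... | no i≢ = trans (cong layer (solution-stay i≢)) (layer-vertex (suc i) p)
  ... | yes refl with even? p
  ...   | yes p-even = trans (cong layer (solution-even p-even)) (layer-vertex _ _)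
  ...   | no p-odd = trans (cong layer (trans (cong (track solution) p≡) (solution-odd q-odd)))
            (trans (layer-vertex _ _) (cong suc class-q))
    where
    q = unshift-k p
    q-odd : ¬ Even q
    q-odd q-even = p-odd (subst Even (shift-unshift-k p) (Even-shift-k q-even))
    class-q : class q ≡ class p
    class-q = trans (sym (class-shift-k q)) (cong class (shift-unshift-k p))
    p≡ : vertex (suc (class p)) p ≡ vertex (suc (class q)) (shift k q)
    p≡ = cong₂ (λ i r → vertex (suc i) r) (sym class-q) (sym (shift-unshift-k p))

  -- Start and destination of every token lie in one layer. This is what later rules out swaps along
  -- fibre edges.
  solution-layer : ∀ u → layer (track solution u) ≡ layer u
  solution-layer u = trans (cong (layer ∘ track solution) (sym (vertex-layer-pos u)))
    (solution-layer-vertex (layer u) (pos u))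

  EdgeList : List (Fin |V| × Fin |V|) → Set
  EdgeList = All (λ { (u , v) → T (adj u v) })

  exchange-edges : EdgeList exchange
  exchange-edges = All.map⁺ (All.tabulate λ {p} _ → Edge⇒adj (fibre-edge p zero≢suc))

  hub-edges : ∀ ps → EdgeList (HubEdges.swaps ps)
  hub-edges ps = All.map⁺ (All.tabulate λ {p} _ → Edge⇒adj (cycle-edge zero p))

  rounds-edges : ∀ r → EdgeList (rounds r)
  rounds-edges zero = []
  rounds-edges (suc r) = All.++⁺ (All.++⁺ (hub-edges evens) (hub-edges odds)) (rounds-edges r)

  solution-edges : EdgeList solution
  solution-edges = All.++⁺ exchange-edges (All.++⁺ (rounds-edges κ) exchange-edges)

  length-exchange : length exchange ≡ L
  length-exchange = trans (length-map _ (allFin L)) (length-tabulate id)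

  length-EO : length (E ++ O) ≡ L
  length-EO = trans (length-++ E) (trans (cong₂ _+_ (length-map _ evens) (length-map _ odds))
    (trans (length-filter-¬ even? (allFin L)) (length-tabulate id)))

  length-rounds : ∀ r → length (rounds r) ≡ r * L
  length-rounds zero = refl
  length-rounds (suc r) = trans (length-++ (E ++ O)) (cong₂ _+_ length-EO (length-rounds r))

  -- Both exchanges use one fibre edge per position, and each round uses every hub edge once, `E`
  -- and `O` together.
  length-solution : length solution ≡ (2 + κ) * L
  length-solution = trans (length-++ exchange) (trans (cong (_+_ (length exchange)) (length-++ (rounds κ)))
    (trans (cong₂ _+_ length-exchange (cong₂ _+_ (length-rounds κ) length-exchange)) (regroup L (κ * L))))
    where
    regroup : ∀ x y → x + (y + x) ≡ x + (x + y)
    regroup = solve-∀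

  -- Tokens are named after their starting vertices, and the destinations are read off from
  -- `solution`, which is therefore valid.
  tokenSwapping : Instance
  tokenSwapping = record
    { n = |V| ; adj = adj ; symmetric = adj-sym ; loopless = adj-irrefl ; connected = connected
    ; weight = λ _ → 1ℚ ; weightPos = λ _ → ℚ.positive⁻¹ 1ℚ
    ; v₀ = Perm.id ; v-f = swaps-perm solution }

-- Generalized locally optimal sequences solve each layer separately.

module _ (I : Instance) where
  swapAt-transpose : ∀ u u' c v → swapAt I u u' c v ≡ c (PC.transpose u u' v)
  swapAt-transpose u u' c v with v ≟ u
  ... | yes _ = refl
  ... | no _ with v ≟ u'
  ...   | yes _ = refl
  ...   | no _ = refl

  -- A configuration maps vertices to tokens, so it evolves by the inverse of the permutation of
  -- positions.
  run-inverse : ∀ c s v → run I c s v ≡ c (swaps-perm s ⟨$⟩ˡ v)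
  run-inverse c [] v = refl
  run-inverse c ((u , u') ∷ s) v = trans (run-inverse (swapAt I u u' c) s v)
    (trans (swapAt-transpose u u' c (swaps-perm s ⟨$⟩ˡ v))
      (cong c (transpose-comm u u' (swaps-perm s ⟨$⟩ˡ v))))

module Layers (k′ κ : ℕ) (k≡κ*2 : suc k′ ≡ κ * 2) (3≤k′ : 3 ≤ k′) where

  open Construction k′ κ k≡κ*2 3≤k′
  open CycleBound k′ k′ 3≤k′

  I : Instance
  I = tokenSwapping

  solution-valid : Valid I solution
  solution-valid = solution-edges , λ t →
    trans (run-inverse I id solution _) (Perm.inverseˡ (swaps-perm solution))

  valid-track : ∀ s → Valid I s → ∀ t → track s t ≡ track solution t
  valid-track s (_ , valid) t = begin
    track s t
      ≡⟨ track-≡ s t ⟩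
    swaps-perm s ⟨$⟩ʳ t
      ≡⟨ cong (swaps-perm s ⟨$⟩ʳ_) (trans (sym (valid t)) (run-inverse I id s _)) ⟩
    swaps-perm s ⟨$⟩ʳ (swaps-perm s ⟨$⟩ˡ (swaps-perm solution ⟨$⟩ʳ t))
      ≡⟨ Perm.inverseʳ (swaps-perm s) ⟩
    swaps-perm solution ⟨$⟩ʳ t
      ≡⟨ track-≡ solution t ⟨
    track solution t ∎
    where open ≡-Reasoning

  -- Contracting the fibre edges of a walk moves it into the layer of its end point.
  project-walk : ∀ {u x d} → Walk adj u x d → ∃ λ d′ → d′ ≤ d × Walk adj (vertex (layer x) (pos u)) x d′
  project-walk {x = x} here = 0 , z≤n , subst (λ u → Walk adj u x 0) (sym (vertex-layer-pos x)) here
  project-walk {x = x} (step {u} {v} e w) with project-walk w | adj⇒Edge e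
  ... | d′ , d′≤d , w′ | fibre _ p≡ = d′ , m≤n⇒m≤1+n d′≤d ,
        subst (λ p → Walk adj (vertex (layer x) p) x d′) (sym p≡) w′
  ... | d′ , d′≤d , w′ | forward _ p≡ = suc d′ , s≤s d′≤d ,
        step (Edge⇒adj (subst (λ p → Edge (vertex (layer x) (pos u)) (vertex (layer x) p)) (sym p≡)
          (cycle-edge _ _))) w′
  ... | d′ , d′≤d , w′ | backward _ p≡ = suc d′ , s≤s d′≤d ,
        step (Edge⇒adj (subst (λ p → Edge (vertex (layer x) p) (vertex (layer x) (pos v))) (sym p≡)
          (Edge-sym (cycle-edge _ _)))) w′

  -- Projecting a shortest walk from `v` to the layer of `x` gives a walk that starts at `u` and is
  -- no longer, so `u` is already as close to `x` as `v` is.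
  fibre-move-not-closer : ∀ {u v x} → pos u ≡ pos v → layer u ≡ layer x → ¬ Decreases I u v x
  fibre-move-not-closer {u} {v} {x} p≡ l≡ (du , dv , (_ , du-min) , (w , _) , dv<du) with project-walk w
  ... | d′ , d′≤dv , w′ = <⇒≱ dv<du (≤-trans (du-min d′ (subst (λ y → Walk adj y x d′) here≡u w′)) d′≤dv)
    where
    here≡u : vertex (layer x) (pos v) ≡ u
    here≡u = trans (cong₂ vertex (sym l≡) (sym p≡)) (vertex-layer-pos u)

  fibre-move-bad : ∀ {t u v} → pos u ≡ pos v → layer t ≡ layer u → ¬ GoodMove I t u v
  fibre-move-bad {t} p≡ l≡ (inj₁ dec) = fibre-move-not-closer p≡
    (trans (sym l≡) (sym (trans (cong layer (sym (track-≡ solution t))) (solution-layer t)))) dec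
  fibre-move-bad p≡ l≡ (inj₂ dec) = fibre-move-not-closer p≡ (sym l≡) dec

  realise : List (Fin N × Fin L) → List (Fin |V| × Fin |V|)
  realise = map (λ { (i , p) → vertex i p , vertex i (next p) })

  LayerPreserving : Config I → Set
  LayerPreserving c = ∀ v → layer (c v) ≡ layer v

  swapAt-layer : ∀ {u u' c} → layer u ≡ layer u' → LayerPreserving c → LayerPreserving (swapAt I u u' c)
  swapAt-layer {u} {u'} l≡ lp v with v ≟ u
  ... | yes refl = trans (lp u') (sym l≡)
  ... | no _ with v ≟ u'
  ...   | yes refl = trans (lp u) l≡
  ...   | no _ = lp v

  -- Induction with the invariant that every token is in its own layer. A fibre swap is then good
  -- for neither token, so each swap uses a cycle edge and preserves the invariant. Edges traversed
  -- backwards are recorded from their other end.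
  within-layers : ∀ c s → LayerPreserving c → AllEdges I s → GLOFrom I c s →
    ∃ λ ls → length ls ≡ length s × (∀ v → track s v ≡ track (realise ls) v)
  within-layers c [] lp _ _ = [] , refl , λ _ → refl
  within-layers c ((u , u') ∷ s) lp (e ∷ es) (good , glo) with adj⇒Edge e
  within-layers c ((u , u') ∷ s) lp (e ∷ es) (inj₁ good , glo) | fibre _ p≡ =
    contradiction good (fibre-move-bad p≡ (lp u))
  within-layers c ((u , u') ∷ s) lp (e ∷ es) (inj₂ good , glo) | fibre _ p≡ =
    contradiction good (fibre-move-bad (sym p≡) (lp u'))
  within-layers c ((u , u') ∷ s) lp (e ∷ es) (good , glo) | forward l≡ p≡
    with within-layers (swapAt I u u' c) s (swapAt-layer l≡ lp) es glo
  ... | ls , len , tr = (layer u , pos u) ∷ ls , cong suc len , λ v →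
        trans (track-∷ u u' s refl) (trans (tr _) (sym (track-∷ _ _ (realise ls)
          (cong₂ (λ x y → PC.transpose x y v) (vertex-layer-pos u)
            (trans (cong₂ vertex l≡ (sym p≡)) (vertex-layer-pos u'))))))
  within-layers c ((u , u') ∷ s) lp (e ∷ es) (good , glo) | backward l≡ p≡
    with within-layers (swapAt I u u' c) s (swapAt-layer l≡ lp) es glo
  ... | ls , len , tr = (layer u' , pos u') ∷ ls , cong suc len , λ v →
        trans (track-∷ u u' s refl) (trans (tr _) (sym (track-∷ _ _ (realise ls)
          (trans (cong₂ (λ x y → PC.transpose x y v) (vertex-layer-pos u')
            (trans (cong₂ vertex (sym l≡) (sym p≡)) (vertex-layer-pos u))) (transpose-comm u' u v)))))

  inLayer : Fin N → List (Fin N × Fin L) → List (Fin L)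
  inLayer i [] = []
  inLayer i ((j , p) ∷ ls) with i ≟ j
  ... | yes _ = p ∷ inLayer i ls
  ... | no _ = inLayer i ls

  length-inLayer : ∀ i j p ls → length (inLayer i ((j , p) ∷ ls)) ≡ indicator j i + length (inLayer i ls)
  length-inLayer i j p ls with i ≟ j
  ... | yes _ = refl
  ... | no _ = refl

  sum-inLayer : ∀ ls → sum (λ i → length (inLayer i ls)) ≡ length ls
  sum-inLayer [] = sum-zero N
  sum-inLayer ((j , p) ∷ ls) = trans (sum-cong-≗ {N} (λ i → length-inLayer i j p ls))
    (trans (∑-distrib-+ {N} (indicator j) (λ i → length (inLayer i ls)))
      (cong₂ _+_ (sum-indicator j) (sum-inLayer ls)))

  transpose-vertex : ∀ i p q r →
    PC.transpose (vertex i p) (vertex i q) (vertex i r) ≡ vertex i (PC.transpose p q r)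
  transpose-vertex i p q r = by-cases (r ≟ p) (r ≟ q)
    where
    by-cases : Dec (r ≡ p) → Dec (r ≡ q) →
      PC.transpose (vertex i p) (vertex i q) (vertex i r) ≡ vertex i (PC.transpose p q r)
    by-cases (yes refl) _ =
      trans (transpose-fst (vertex i p) (vertex i q)) (cong (vertex i) (sym (transpose-fst r q)))
    by-cases (no _) (yes refl) =
      trans (transpose-snd (vertex i p) (vertex i q)) (cong (vertex i) (sym (transpose-snd p r)))
    by-cases (no r≢p) (no r≢q) =
      trans (transpose-other (pos≢ r≢p) (pos≢ r≢q)) (cong (vertex i) (sym (transpose-other r≢p r≢q)))

  -- Swaps in other layers fix every vertex of layer `i`, so its tokens see only the swaps in
  -- `inLayer i ls`.
  track-inLayer : ∀ i ls p → track (realise ls) (vertex i p) ≡ vertex i (track (cyclic (inLayer i ls)) p)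
  track-inLayer i [] p = trans (track-[] _) (cong (vertex i) (sym (track-[] p)))
  track-inLayer i ((j , q) ∷ ls) p with i ≟ j
  ... | yes refl = trans (track-∷ _ _ (realise ls) (transpose-vertex i q (next q) p))
        (trans (track-inLayer i ls _) (cong (vertex i) (sym (track-∷ q (next q) (cyclic (inLayer i ls)) refl))))
  ... | no i≢j = trans (track-∷ _ _ (realise ls) (transpose-other (layer≢ i≢j) (layer≢ i≢j)))
        (track-inLayer i ls p)

  module _ (s : List (Fin |V| × Fin |V|)) (valid : Valid I s) (glo : GeneralizedLocallyOptimal I s) where

    layered : ∃ λ ls → length ls ≡ length s × (∀ v → track s v ≡ track (realise ls) v)
    layered = within-layers id s (λ _ → refl) (proj₁ valid) glo

    layerSwaps : Fin N → List (Fin L)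
    layerSwaps i = inLayer i (proj₁ layered)

    track-layer : ∀ {i p q} → track solution (vertex i p) ≡ vertex i q → track (cyclic (layerSwaps i)) p ≡ q
    track-layer {i} {p} eq = pos-injective (trans (sym (track-inLayer i (proj₁ layered) p))
      (trans (sym (proj₂ (proj₂ layered) (vertex i p))) (trans (valid-track s valid (vertex i p)) eq)))

    class-≡ : ∀ (i : Fin k) p → toℕ p % k ≡ toℕ i % k → class p ≡ i
    class-≡ i p eq = Fin.toℕ-injective (trans (toℕ-class p) (trans eq (m<n⇒m%n≡m (Fin.toℕ<n i))))

    class-≢ : ∀ (i : Fin k) p → toℕ p % k ≢ toℕ i % k → i ≢ class p
    class-≢ i p neq refl = neq (sym (trans (cong (_% k) (toℕ-class p)) (m%n%n≡m%n (toℕ p) k)))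

    -- As `k` is even, the class determines the parity, so all travellers of a layer go in the same
    -- direction.
    Even-class : ∀ p → toℕ (class p) % 2 ≡ toℕ p % 2
    Even-class p = trans (cong (_% 2) (toℕ-class p)) (m∣n⇒o%n%m≡o%m 2 k (toℕ p) 2∣k)

    -- In an odd layer the tokens travel backwards, so the bound applies to the reversed sequence.
    layer-bound : ∀ (i : Fin k) → k′ * (1 + 2 * k′) ≤ length (layerSwaps (suc i))
    layer-bound i with toℕ i % 2 ℕ.≟ 0
    ... | yes i-even = cycle-bound (toℕ i) (layerSwaps (suc i)) travels stays
      where
      travels : ∀ p → toℕ p % k ≡ toℕ i % k → track (cyclic (layerSwaps (suc i))) p ≡ shift k p
      travels p p∈ with class-≡ i p p∈
      ... | refl = track-layer (solution-even (trans (sym (Even-class p)) i-even))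
      stays : ∀ p → toℕ p % k ≢ toℕ i % k → track (cyclic (layerSwaps (suc i))) p ≡ p
      stays p p∉ = track-layer (solution-stay (class-≢ i p p∉))
    ... | no i-odd = subst (k′ * (1 + 2 * k′) ≤_) (length-reverse (layerSwaps (suc i)))
      (cycle-bound (toℕ i) (reverse (layerSwaps (suc i))) travels stays)
      where
      reversed : ∀ {p q} → track (cyclic (layerSwaps (suc i))) q ≡ p →
        track (cyclic (reverse (layerSwaps (suc i)))) p ≡ q
      reversed {p} {q} eq = trans (cong₂ track (reverse-map _ (layerSwaps (suc i))) (sym eq))
        (track-reverse (cyclic (layerSwaps (suc i))) q)
      travels : ∀ p → toℕ p % k ≡ toℕ i % k → track (cyclic (reverse (layerSwaps (suc i)))) p ≡ shift k p
      travels p p∈ with class-≡ i p p∈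
      ... | refl = reversed (track-layer (solution-odd (i-odd ∘ trans (Even-class p))))
      stays : ∀ p → toℕ p % k ≢ toℕ i % k → track (cyclic (reverse (layerSwaps (suc i)))) p ≡ p
      stays p p∉ = reversed (track-layer (solution-stay (class-≢ i p p∉)))

    glo-length : k * (k′ * (1 + 2 * k′)) ≤ length s
    glo-length = begin
      k * (k′ * (1 + 2 * k′))                           ≡⟨ sum-const k _ ⟨
      sum {k} (λ _ → k′ * (1 + 2 * k′))                 ≤⟨ sum-mono layer-bound ⟩
      sum {k} (λ i → length (layerSwaps (suc i)))       ≤⟨ m≤n+m _ (length (layerSwaps zero)) ⟩
      sum {N} (λ i → length (layerSwaps i))             ≡⟨ sum-inLayer (proj₁ layered) ⟩
      length (proj₁ layered)                            ≡⟨ proj₁ (proj₂ layered) ⟩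
      length s ∎
      where open ≤-Reasoning

-- From rational costs to an inequality of natural numbers.

fromℕ : ℕ → ℚ
fromℕ m = + m ℚ./ 1

toℚᵘ-fromℕ : ∀ m → toℚᵘ (fromℕ m) ℚᵘ.≃ mkℚᵘ (+ m) 0
toℚᵘ-fromℕ m = ℚ.toℚᵘ-fromℚᵘ (mkℚᵘ (+ m) 0)

fromℕ-+ : ∀ m n → fromℕ m ℚ.+ fromℕ n ≡ fromℕ (m ℕ.+ n)
fromℕ-+ m n = ℚ.toℚᵘ-injective (begin
  toℚᵘ (fromℕ m ℚ.+ fromℕ n)             ≈⟨ ℚ.toℚᵘ-homo-+ (fromℕ m) (fromℕ n) ⟩
  toℚᵘ (fromℕ m) ℚᵘ.+ toℚᵘ (fromℕ n)     ≈⟨ ℚᵘ.+-cong (toℚᵘ-fromℕ m) (toℚᵘ-fromℕ n) ⟩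
  mkℚᵘ (+ m) 0 ℚᵘ.+ mkℚᵘ (+ n) 0         ≈⟨ *≡* (regroup (+ m) (+ n)) ⟩
  mkℚᵘ (+ (m ℕ.+ n)) 0                   ≈⟨ toℚᵘ-fromℕ (m ℕ.+ n) ⟨
  toℚᵘ (fromℕ (m ℕ.+ n)) ∎)
  where
  open ℚᵘ.≃-Reasoning
  regroup : ∀ x y → (x ℤ.* (+ 1) ℤ.+ y ℤ.* (+ 1)) ℤ.* (+ 1) ≡ (x ℤ.+ y) ℤ.* (+ 1)
  regroup = ℤ-Solver.solve-∀

fromℕ-mono-≤ : ∀ {m n} → m ℕ.≤ n → fromℕ m ℚ.≤ fromℕ n
fromℕ-mono-≤ {m} {n} m≤n = ℚ.toℚᵘ-cancel-≤
  (ℚᵘ.≤-respˡ-≃ (ℚᵘ.≃-sym (toℚᵘ-fromℕ m)) (ℚᵘ.≤-respʳ-≃ (ℚᵘ.≃-sym (toℚᵘ-fromℕ n))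
  (*≤* (ℤ.*-monoʳ-≤-nonNeg (+ 1) (ℤ.+≤+ m≤n)))))

-- For unit weights the factor is 4 minus `δ`. Multiplying by the denominator of `δ` clears all
-- fractions, and the numerator of `δ`, being positive, is replaced by its lower bound 1.
factor-bound : ∀ δ (δ>0 : 0ℚ ℚ.< δ) (1>0 : 0ℚ ℚ.< 1ℚ) c o →
  fromℕ c ℚ.≤ factor δ 1ℚ 1ℚ 1>0 ℚ.* fromℕ o → ℚ.↧ₙ δ ℕ.* c ℕ.+ o ℕ.≤ 4 ℕ.* ℚ.↧ₙ δ ℕ.* o
factor-bound δ δ>0 1>0 c o c≤ with ℚ.positive δ>0
factor-bound δ@(mkℚ (+ suc a) d-1 _) δ>0 1>0 c o c≤ | _ = ℤ.drop‿+≤+ (begin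
  + (D ℕ.* c ℕ.+ o)                                       ≡⟨ cong (ℤ._+ + o) (ℤ.pos-* D c) ⟩
  + D ℤ.* + c ℤ.+ + o                                     ≤⟨ ℤ.+-monoʳ-≤ (+ D ℤ.* + c) (ℤ.+≤+ (m≤m+n o (a ℕ.* o))) ⟩
  + D ℤ.* + c ℤ.+ + (suc a ℕ.* o)                         ≡⟨ cong₂ ℤ._+_ (ℤ.*-comm (+ D) (+ c)) (ℤ.pos-* (suc a) o) ⟩
  + c ℤ.* + D ℤ.+ + suc a ℤ.* + o                         ≤⟨ ℤ.+-monoˡ-≤ (+ suc a ℤ.* + o) bound ⟩
  (+ 4 ℤ.* + D ℤ.+ ℤ.- + suc a) ℤ.* + o ℤ.+ + suc a ℤ.* + o    ≡⟨ cancel (+ D) (+ suc a) (+ o) ⟩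
  + 4 ℤ.* + D ℤ.* + o                                     ≡⟨ cong (ℤ._* + o) (ℤ.pos-* 4 D) ⟨
  + (4 ℕ.* D) ℤ.* + o                                     ≡⟨ ℤ.pos-* (4 ℕ.* D) o ⟨
  + (4 ℕ.* D ℕ.* o) ∎)
  where
  open ℤ.≤-Reasoning
  D = suc d-1
  cancel : ∀ x y z → (+ 4 ℤ.* x ℤ.+ ℤ.- y) ℤ.* z ℤ.+ y ℤ.* z ≡ + 4 ℤ.* x ℤ.* z
  cancel = ℤ-Solver.solve-∀
  unit : ∀ x y z → (x ℤ.+ y ℤ.* + 1) ℤ.* z ℤ.* + 1 ≡ (x ℤ.+ y) ℤ.* z
  unit = ℤ-Solver.solve-∀
  rhs : toℚᵘ (factor δ 1ℚ 1ℚ 1>0 ℚ.* fromℕ o) ℚᵘ.≃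
    (mkℚᵘ (+ 4) 0 ℚᵘ.+ mkℚᵘ -[1+ a ] d-1) ℚᵘ.* mkℚᵘ (+ o) 0
  rhs = ℚᵘ.≃-trans (ℚ.toℚᵘ-homo-* (factor δ 1ℚ 1ℚ 1>0) (fromℕ o)) (ℚᵘ.*-cong
    (ℚ.toℚᵘ-homo-+ (+ 4 ℚ./ 1) (ℚ.- δ)) (toℚᵘ-fromℕ o))
  bound : + c ℤ.* + D ℤ.≤ (+ 4 ℤ.* + D ℤ.+ ℤ.- + suc a) ℤ.* + o
  bound = subst₂ ℤ._≤_
    (cong (λ e → + c ℤ.* + e) (trans (*-identityʳ (1 ℕ.* D)) (*-identityˡ D)))
    (unit (+ 4 ℤ.* + D) (ℤ.- + suc a) (+ o))
    (ℚᵘ.drop-*≤* (ℚᵘ.≤-respˡ-≃ (toℚᵘ-fromℕ c) (ℚᵘ.≤-respʳ-≃ rhs (ℚ.toℚᵘ-mono-≤ c≤))))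

-- Here 1 / D ≤ δ, and k is even and large enough for (2k′ + 1) k′ / (k (k / 2 + 2)) > 4 − δ.
gap-contradiction : ∀ D C o → let k′ = 22 * D + 23 ; k = suc k′ in
  k * (k′ * (1 + 2 * k′)) ≤ C → o ≤ (2 + (11 * D + 12)) * (k * k) →
  .{{_ : NonZero D}} → ¬ (D * C + o ≤ 4 * D * o)
gap-contradiction D C o C≥ o≤ hyp = <⇒≱ (begin-strict
    16 * D * ((2 + (11 * D + 12)) * (k * k))         ≡⟨ lhs D k ⟩
    k * (16 * D * (14 + 11 * D) * k)                 <⟨ *-monoʳ-< k (m+1+n≡o⇒m<o (identity D)) ⟩
    k * ((4 * D + 1) * (k′ * (1 + 2 * k′)))          ≡⟨ rhs D k (k′ * (1 + 2 * k′)) ⟩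
    (4 * D + 1) * (k * (k′ * (1 + 2 * k′))) ∎)
  (begin
    (4 * D + 1) * (k * (k′ * (1 + 2 * k′)))          ≤⟨ *-monoʳ-≤ (4 * D + 1) C≥ ⟩
    (4 * D + 1) * C                                  ≡⟨ expand D C ⟩
    4 * (D * C) + C                                  ≤⟨ +-monoʳ-≤ (4 * (D * C)) C≤4o ⟩
    4 * (D * C) + 4 * o                              ≡⟨ *-distribˡ-+ 4 (D * C) o ⟨
    4 * (D * C + o)                                  ≤⟨ *-monoʳ-≤ 4 hyp ⟩
    4 * (4 * D * o)                                  ≡⟨ assoc D o ⟩
    16 * D * o                                       ≤⟨ *-monoʳ-≤ (16 * D) o≤ ⟩
    16 * D * ((2 + (11 * D + 12)) * (k * k)) ∎)
  where
  open ≤-Reasoning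
  k′ = 22 * D + 23
  k = suc k′
  lhs : ∀ D k → 16 * D * ((2 + (11 * D + 12)) * (k * k)) ≡ k * (16 * D * (14 + 11 * D) * k)
  lhs = solve-∀
  -- The coefficients of the cube and the square of `D` agree on both sides of the strict
  -- inequality; the positive surplus is `994 * D + 1081`.
  identity : ∀ D → 16 * D * (14 + 11 * D) * suc (22 * D + 23) + suc (994 * D + 1080) ≡
    (4 * D + 1) * ((22 * D + 23) * (1 + 2 * (22 * D + 23)))
  identity = solve-∀
  rhs : ∀ D k x → k * ((4 * D + 1) * x) ≡ (4 * D + 1) * (k * x)
  rhs = solve-∀
  expand : ∀ D C → (4 * D + 1) * C ≡ 4 * (D * C) + C
  expand = solve-∀
  m+1+n≡o⇒m<o : ∀ {m n o} → m + suc n ≡ o → m < o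
  m+1+n≡o⇒m<o refl = m<m+n _ (s≤s z≤n)
  assoc : ∀ D o → 4 * (4 * D * o) ≡ 16 * D * o
  assoc = solve-∀
  swap : ∀ D o → 4 * D * o ≡ D * (4 * o)
  swap = solve-∀
  C≤4o : C ≤ 4 * o
  C≤4o = *-cancelˡ-≤ D (≤-trans (m≤m+n (D * C) o) (≤-trans hyp (≤-reflexive (swap D o))))

-- Optimal solutions and the contradiction.

-- Descent on the length. As `P` need not be decidable, a minimum is available only under double
-- negation, which suffices for deriving a contradiction.
¬¬-shortest : ∀ {A : Set} {P : List A → Set} → ∀ s → P s →
  ¬ ¬ (∃ λ s → P s × (∀ s′ → P s′ → length s ≤ length s′))
¬¬-shortest {A} {P} s Ps none = search (suc (length s)) s Ps ≤-refl
  where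
  search : ∀ m s → P s → length s < m → ⊥
  search (suc m) s Ps (s≤s l≤m) = none (s , Ps , shortest)
    where
    shortest : ∀ s′ → P s′ → length s ≤ length s′
    shortest s′ Ps′ with length s ≤? length s′
    ... | yes l≤ = l≤
    ... | no l≰ = contradiction (<-≤-trans (≰⇒> l≰) l≤m) (search m s′ Ps′)

module _ (I : Instance) (unit : ∀ t → Instance.weight I t ≡ 1ℚ) where

  costFrom-unit : ∀ c s → costFrom I c s ≡ fromℕ (2 * length s)
  costFrom-unit c [] = refl
  costFrom-unit c ((u , u′) ∷ s)
    rewrite unit (c u) | unit (c u′) | costFrom-unit (swapAt I u u′ c) s =
    trans (fromℕ-+ 2 (2 * length s)) (cong fromℕ (sym (*-suc 2 (length s))))

theorem4 : ∀ (δ : ℚ) → 0ℚ ℚ.< δ →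
    ¬ (∃ λ (A : (I : Instance) → List (Swap I)) → GLOApproxAlgorithm δ A)
theorem4 δ δ>0 (A , approx) = ¬¬-shortest {P = Valid I} solution solution-valid
  λ { (s , s-valid , s-shortest) →
    gap-contradiction D (length (A I)) (length s)
      (glo-length (A I) A-valid A-glo)
      (≤-trans (s-shortest solution solution-valid) (≤-reflexive length-solution))
      (ratio s s-valid s-shortest) }
  where
  D = ℚ.↧ₙ δ
  k′≡ : ∀ D → suc (22 * D + 23) ≡ (11 * D + 12) * 2
  k′≡ = solve-∀
  k′ = 22 * D + 23
  κ = 11 * D + 12
  3≤k′ : 3 ≤ k′
  3≤k′ = ≤-trans (s≤s (s≤s (s≤s z≤n))) (m≤n+m 23 (22 * D))
  open Construction k′ κ (k′≡ D) 3≤k′ using (vertex; solution; length-solution)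
  open Layers k′ κ (k′≡ D) 3≤k′
  min : IsMinWeight I 1ℚ
  min = (vertex zero zero , refl) , λ _ → ℚ.≤-refl
  max : IsMaxWeight I 1ℚ
  max = (vertex zero zero , refl) , λ _ → ℚ.≤-refl
  cost-length : ∀ s → cost I s ≡ fromℕ (2 * length s)
  cost-length = costFrom-unit I (λ _ → refl) (initial I)
  A-valid = proj₁ (approx I)
  A-glo = proj₁ (proj₂ (approx I))
  double-left : ∀ D C o → D * (2 * C) + 2 * o ≡ 2 * (D * C + o)
  double-left = solve-∀
  double-right : ∀ D o → 4 * D * (2 * o) ≡ 2 * (4 * D * o)
  double-right = solve-∀
  ratio : ∀ s → Valid I s → (∀ s′ → Valid I s′ → length s ≤ length s′) →
    D * length (A I) + length s ≤ 4 * D * length s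
  -- Every swap costs 2, so both costs are twice the lengths and the common factor cancels.
  ratio s s-valid s-shortest = *-cancelˡ-≤ 2 (subst₂ _≤_
    (double-left D (length (A I)) (length s)) (double-right D (length s))
    (factor-bound δ δ>0 (minWeight-pos I min) (2 * length (A I)) (2 * length s)
      (subst₂ (λ c o → c ℚ.≤ factor δ 1ℚ 1ℚ (minWeight-pos I min) ℚ.* o)
        (cost-length (A I)) (cost-length s)
        (proj₂ (proj₂ (approx I)) 1ℚ 1ℚ (cost I s) min max optimal))))
    where
    optimal : IsOPT I (cost I s)
    optimal = (s , s-valid , refl) , λ s′ s′-valid →
      subst₂ ℚ._≤_ (sym (cost-length s)) (sym (cost-length s′))
      (fromℕ-mono-≤ (*-monoʳ-≤ 2 (s-shortest s′ s′-valid)))
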